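{- For all integers $n,m\geq 1$ we have $choice_*^{n+m}\vdash_h AC^{n,m}$, i.e. the formula $AC^{n,m}$ is derivable in second-order predicate logic with Henkin interpretation from the set of all Asser axioms $choice_*^{n+m}(H)$.
   Context: Work in second-order predicate logic with Henkin interpretation (HPL). A second-order variable of sort $k$ ranges over $k$-ary predicates. For $n,m\geq1$, $\mathbf{x}$ denotes a tuple $x_1,\dots,x_n$ of individual variables and $\mathbf{y}$ a tuple $y_1,\dots,y_m$; $\exists!!\mathbf{y}\,\varphi$ means "there is exactly one tuple $\mathbf{y}$ with $\varphi$"; for predicate variables, $C_1\neq C_2$ means $\neg\forall\mathbf{y}(C_1\mathbf{y}\leftrightarrow C_2\mathbf{y})$. ${}^hax^{(2)}$ is the axiom system of HPL (its models are exactly the Henkin structures of second order, i.e. structures $(J_k)_{k\ge0}$ with $J_0$ a nonempty individual domain and $J_k$ a set of $k$-ary predicates closed under second-order definability). For a set ${\cal G}$ of formulas, ${\cal G}\vdash_h F$ means $F$ is derivable from ${}^hax^{(2)}\cup{\cal G}$ with the usual rules of inference. Zermelo–Asser axiom: with $A$ of sort $n$ and $R,S$ of sort $n+m$, $AC^{n,m}=\forall A\forall R\exists S(\forall\mathbf{x}(A\mathbf{x}\leftrightarrow\exists\mathbf{y}R\mathbf{x}\mathbf{y})\to\forall\mathbf{x}(A\mathbf{x}\to\exists!!\mathbf{y}(R\mathbf{x}\mathbf{y}\land S\mathbf{x}\mathbf{y})))$. Asser axioms: for $k\ge1$, with $C,C_1,C_2,D$ of sort $k$, $\mathbf{y}$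 a $k$-tuple, and $H=H(C)$ any second-order formula in which $C$ occurs free, $choice_*^{k}(H)=\forall C(H(C)\to\exists\mathbf{y}C\mathbf{y})\land\forall C_1\forall C_2(H(C_1)\land H(C_2)\land C_1\neq C_2\to\neg\exists\mathbf{y}(C_1\mathbf{y}\land C_2\mathbf{y}))\to\exists D\forall C(H(C)\to\exists!!\mathbf{y}(C\mathbf{y}\land D\mathbf{y}))$, and $choice_*^k$ is the set of all $choice_*^k(H)$ for such $H$. -}

module Defs where

-- Syntax is well-scoped de Bruijn: a context is a list of sorts,
-- sort 0 = individual variable, sort k ≥ 1 = k-ary predicate variable.

open import Data.Nat using (ℕ; zero; suc; _+_)
open import Data.List using (List; []; _∷_; _++_; replicate)
open import Data.Vec as V using (Vec; []; _∷_; _∷ʳ_)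
open import Data.Vec.Membership.Propositional using (_∈_)

Ctx : Set
Ctx = List ℕ

infix 4 _∋_
data _∋_ : Ctx → ℕ → Set where
  here  : ∀ {Γ s} → (s ∷ Γ) ∋ s
  there : ∀ {Γ s t} → Γ ∋ s → (t ∷ Γ) ∋ s

infixr 5 _⇒_
infix 7 _≐_

data Fm (Γ : Ctx) : Set where
  ⊥'  : Fm Γ
  _⇒_ : Fm Γ → Fm Γ → Fm Γ
  ∀'  : (s : ℕ) → Fm (s ∷ Γ) → Fm Γ
  _≐_ : Γ ∋ 0 → Γ ∋ 0 → Fm Γ
  app : ∀ {k} → Γ ∋ suc k → Vec (Γ ∋ 0) (suc k) → Fm Γ

Ren : Ctx → Ctx → Set
Ren Γ Δ = ∀ {s} → Γ ∋ s → Δ ∋ s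

ext : ∀ {Γ Δ t} → Ren Γ Δ → Ren (t ∷ Γ) (t ∷ Δ)
ext ρ here      = here
ext ρ (there x) = there (ρ x)

ren : ∀ {Γ Δ} → Ren Γ Δ → Fm Γ → Fm Δ
ren ρ ⊥'         = ⊥'
ren ρ (φ ⇒ ψ)    = ren ρ φ ⇒ ren ρ ψ
ren ρ (∀' s φ)   = ∀' s (ren (ext ρ) φ)
ren ρ (x ≐ y)    = ρ x ≐ ρ y
ren ρ (app X xs) = app (ρ X) (V.map ρ xs)

wk : ∀ {Γ s} → Fm Γ → Fm (s ∷ Γ)
wk = ren there

sub1 : ∀ {Γ s} → Γ ∋ s → Ren (s ∷ Γ) Γ
sub1 v here      = v
sub1 v (there x) = x

inst : ∀ {Γ s} → Fm (s ∷ Γ) → Γ ∋ s → Fm Γ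
inst φ v = ren (sub1 v) φ

wkR : ∀ {Γ} (Ψ : Ctx) → Ren Γ (Ψ ++ Γ)
wkR []      x = x
wkR (_ ∷ Ψ) x = there (wkR Ψ x)

liftR : ∀ {Γ Δ} (Ψ : Ctx) → Ren Γ Δ → Ren (Ψ ++ Γ) (Ψ ++ Δ)
liftR []      ρ x = ρ x
liftR (_ ∷ Ψ) ρ x = ext (liftR Ψ ρ) x

data Occ : ∀ {Γ s} → Γ ∋ s → Fm Γ → Set where
  occ⇒ˡ : ∀ {Γ s} {v : Γ ∋ s} {φ ψ} → Occ v φ → Occ v (φ ⇒ ψ)
  occ⇒ʳ : ∀ {Γ s} {v : Γ ∋ s} {φ ψ} → Occ v ψ → Occ v (φ ⇒ ψ)
  occ∀  : ∀ {Γ s t} {v : Γ ∋ s} {φ : Fm (t ∷ Γ)} → Occ (there v) φ → Occ v (∀' t φ)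
  occ≐ˡ : ∀ {Γ} {x y : Γ ∋ 0} → Occ x (x ≐ y)
  occ≐ʳ : ∀ {Γ} {x y : Γ ∋ 0} → Occ y (x ≐ y)
  occP  : ∀ {Γ k} {X : Γ ∋ suc k} {xs} → Occ X (app X xs)
  occArg : ∀ {Γ k} {x : Γ ∋ 0} {X : Γ ∋ suc k} {xs} → x ∈ xs → Occ x (app X xs)

infixr 6 _∧'_
infix 5 _⇔_

¬' : ∀ {Γ} → Fm Γ → Fm Γ
¬' φ = φ ⇒ ⊥'

⊤' : ∀ {Γ} → Fm Γ
⊤' = ¬' ⊥'

_∧'_ : ∀ {Γ} → Fm Γ → Fm Γ → Fm Γ
φ ∧' ψ = ¬' (φ ⇒ ¬' ψ)

_⇔_ : ∀ {Γ} → Fm Γ → Fm Γ → Fm Γ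
φ ⇔ ψ = (φ ⇒ ψ) ∧' (ψ ⇒ φ)

∃' : ∀ {Γ} (s : ℕ) → Fm (s ∷ Γ) → Fm Γ
∃' s φ = ¬' (∀' s (¬' φ))

-- blocks of k individual variables  x_1 … x_k  (x_1 outermost)
ι^ : ℕ → Ctx
ι^ k = replicate k 0

∀ⁿ : ∀ {Γ} (k : ℕ) → Fm (ι^ k ++ Γ) → Fm Γ
∀ⁿ zero    φ = φ
∀ⁿ (suc k) φ = ∀ⁿ k (∀' 0 φ)

∃ⁿ : ∀ {Γ} (k : ℕ) → Fm (ι^ k ++ Γ) → Fm Γ
∃ⁿ zero    φ = φ
∃ⁿ (suc k) φ = ∃ⁿ k (∃' 0 φ)

tup : ∀ {Γ} (k : ℕ) → Vec ((ι^ k ++ Γ) ∋ 0) k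
tup zero    = []
tup (suc k) = V.map there (tup k) ∷ʳ here

⋀ : ∀ {Γ k} → Vec (Fm Γ) k → Fm Γ
⋀ = V.foldr _ _∧'_ ⊤'

_≐⃗_ : ∀ {Γ k} → Vec (Γ ∋ 0) k → Vec (Γ ∋ 0) k → Fm Γ
xs ≐⃗ ys = ⋀ (V.zipWith _≐_ xs ys)

∃!!ⁿ : ∀ {Γ} (k : ℕ) → Fm (ι^ k ++ Γ) → Fm Γ
∃!!ⁿ k φ =
  ∃ⁿ k (φ ∧' ∀ⁿ k (ren (liftR (ι^ k) (wkR (ι^ k))) φ
                    ⇒ (tup k ≐⃗ V.map (wkR (ι^ k)) (tup k))))

_≠'_ : ∀ {Γ k} → Γ ∋ suc k → Γ ∋ suc k → Fm Γ
_≠'_ {k = k} C₁ C₂ =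
  ¬' (∀ⁿ (suc k) (app (wkR (ι^ (suc k)) C₁) (tup (suc k))
                  ⇔ app (wkR (ι^ (suc k)) C₂) (tup (suc k))))

-- Asser axiom  choice_*^{suc k}(H),  H = H(C) with C the variable 'here'
-- (H may contain further free variables as parameters, from Γ)

choice* : ∀ {Γ} (k : ℕ) → Fm (suc k ∷ Γ) → Fm Γ
choice* {Γ} k H = (hyp₁ ∧' hyp₂) ⇒ concl
  where
  K = suc k
  hyp₁ = ∀' K (H ⇒ ∃ⁿ K (app (wkR (ι^ K) here) (tup K)))
  -- context  C₂ ∷ C₁ ∷ Γ
  ρ₁ : Ren (K ∷ Γ) (K ∷ K ∷ Γ)
  ρ₁ here      = there here
  ρ₁ (there x) = there (there x)
  ρ₂ : Ren (K ∷ Γ) (K ∷ K ∷ Γ)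
  ρ₂ here      = here
  ρ₂ (there x) = there (there x)
  hyp₂ = ∀' K (∀' K ((ren ρ₁ H ∧' ren ρ₂ H ∧' (there here ≠' here))
            ⇒ ¬' (∃ⁿ K (app (wkR (ι^ K) (there here)) (tup K)
                         ∧' app (wkR (ι^ K) here) (tup K)))))
  -- context  C ∷ D ∷ Γ :  ∃D ∀C (H(C) → ∃!!y (C y ∧ D y))
  concl = ∃' K (∀' K (ren (ext there) H
            ⇒ ∃!!ⁿ K (app (wkR (ι^ K) here) (tup K)
                      ∧' app (wkR (ι^ K) (there here)) (tup K))))

Hyps : Set₁
Hyps = (Γ : Ctx) → Fm Γ → Set

-- the set  choice_*^K  (only for K ≥ 1; empty for K = 0),
-- H ranging over all formulas in which C occurs free
data Choice* : ℕ → Hyps where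
  asser : ∀ {k Γ} (H : Fm (suc k ∷ Γ)) → Occ here H → Choice* (suc k) Γ (choice* k H)

-- Zermelo–Asser axiom  AC^{n,m}  for n = suc n', m = suc m'

AC : (n' m' : ℕ) → Fm []
AC n' m' = ∀' n (∀' (n + m) (∃' (n + m) (P₁ ⇒ P₂)))
  where
  n = suc n'
  m = suc m'
  Γ₀ : Ctx
  Γ₀ = (n + m) ∷ (n + m) ∷ n ∷ []
  S R : Γ₀ ∋ n + m
  S = here
  R = there here
  A : Γ₀ ∋ n
  A = there (there here)
  xy : Vec ((ι^ m ++ ι^ n ++ Γ₀) ∋ 0) (n + m)
  xy = V.map (wkR (ι^ m)) (tup n) V.++ tup m
  ↑↑ : ∀ {s} → Γ₀ ∋ s → (ι^ m ++ ι^ n ++ Γ₀) ∋ s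
  ↑↑ v = wkR (ι^ m) (wkR (ι^ n) v)
  P₁ = ∀ⁿ n (app (wkR (ι^ n) A) (tup n) ⇔ ∃ⁿ m (app (↑↑ R) xy))
  P₂ = ∀ⁿ n (app (wkR (ι^ n) A) (tup n)
             ⇒ ∃!!ⁿ m (app (↑↑ R) xy ∧' app (↑↑ S) xy))

data Der (G : Hyps) : (Γ : Ctx) → Fm Γ → Set where
  hyp  : ∀ {Γ φ} → G Γ φ → Der G Γ φ
  ax-K : ∀ {Γ} (φ ψ : Fm Γ) → Der G Γ (φ ⇒ ψ ⇒ φ)
  ax-S : ∀ {Γ} (φ ψ χ : Fm Γ) → Der G Γ ((φ ⇒ ψ ⇒ χ) ⇒ (φ ⇒ ψ) ⇒ φ ⇒ χ)
  ax-DN : ∀ {Γ} (φ : Fm Γ) → Der G Γ (¬' (¬' φ) ⇒ φ)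
  ax-inst : ∀ {Γ s} (φ : Fm (s ∷ Γ)) (v : Γ ∋ s) → Der G Γ (∀' s φ ⇒ inst φ v)
  ax-dist : ∀ {Γ s} (φ ψ : Fm (s ∷ Γ)) → Der G Γ (∀' s (φ ⇒ ψ) ⇒ ∀' s φ ⇒ ∀' s ψ)
  ax-vac : ∀ {Γ s} (φ : Fm Γ) (ψ : Fm (s ∷ Γ)) → Der G Γ (∀' s (wk φ ⇒ ψ) ⇒ φ ⇒ ∀' s ψ)
  ax-refl : ∀ {Γ} (x : Γ ∋ 0) → Der G Γ (x ≐ x)
  ax-subst : ∀ {Γ} (φ : Fm (0 ∷ Γ)) (x y : Γ ∋ 0) → Der G Γ (x ≐ y ⇒ inst φ x ⇒ inst φ y)
  ax-comp : ∀ {Γ} (k : ℕ) (φ : Fm (ι^ (suc k) ++ Γ)) →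
    Der G Γ (∃' (suc k) (∀ⁿ (suc k)
      (app (wkR (ι^ (suc k)) here) (tup (suc k)) ⇔ ren (liftR (ι^ (suc k)) there) φ)))
  mp  : ∀ {Γ φ ψ} → Der G Γ (φ ⇒ ψ) → Der G Γ φ → Der G Γ ψ
  gen : ∀ {Γ s φ} → Der G (s ∷ Γ) φ → Der G Γ (∀' s φ)
  -- all domains J_k are nonempty: a variable not occurring may be dropped
  str : ∀ {Γ s φ} → Der G (s ∷ Γ) (wk φ) → Der G Γ φ

_⊢h_ : Hyps → Fm [] → Set
G ⊢h F = Der G [] F

-- For x ∈ A let C_x = {x y ∣ R x y} be the fiber of R over x. If A = dom R the fibers are
-- nonempty, and two fibers sharing a point x₁ y₁ = x₂ y₂ have x₁ = x₂ and therefore coincide,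
-- so distinct fibers are disjoint. An Asser axiom then gives D meeting every fiber in exactly
-- one point, and S := D picks exactly one y with R x y for every x ∈ A. The axiom is applied to
-- H(C) := (A = dom R ∧ C is the fiber over some x ∈ A): with the antecedent of AC^{n,m} built
-- into H, both hypotheses of the axiom are provable outright and no case distinction is needed.

{-# OPTIONS --safe #-}
module Submission where

open import Defs
open import Data.Nat using (ℕ; zero; suc; _+_)
open import Data.List as L using (List; []; _∷_; _++_)
import Data.List.Properties as Listₚ
open import Data.Vec as V using (Vec; []; _∷_; _∷ʳ_)
open import Data.Vec.Properties using (map-cong; map-∘; map-id; map-++; map-∷ʳ)
open import Data.Vec.Membership.Propositional.Properties using (∈-map⁺)
open import Data.Product using (proj₂)
open import Relation.Binary.PropositionalEquality

variable
  Γ Δ Δ′ Θ : Ctx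
  s t j k : ℕ
  φ ψ χ : Fm Γ
  Φs : List (Fm Γ)

cong₃ : ∀ {A B C D : Set} (f : A → B → C → D) {a a′ b b′ c c′} →
  a ≡ a′ → b ≡ b′ → c ≡ c′ → f a b c ≡ f a′ b′ c′
cong₃ f refl refl refl = refl

cong₄ : ∀ {A B C D E : Set} (f : A → B → C → D → E) {a a′ b b′ c c′ d d′} →
  a ≡ a′ → b ≡ b′ → c ≡ c′ → d ≡ d′ → f a b c d ≡ f a′ b′ c′ d′
cong₄ f refl refl refl refl = refl

-- Renamings

infix 4 _≗ᴿ_
_≗ᴿ_ : Ren Γ Δ → Ren Γ Δ → Set
ρ ≗ᴿ σ = ∀ {s} (x : _ ∋ s) → ρ x ≡ σ x

infixr 9 _∘ᴿ_
_∘ᴿ_ : Ren Δ Θ → Ren Γ Δ → Ren Γ Θ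
(ρ ∘ᴿ σ) x = ρ (σ x)

ext-cong : {ρ σ : Ren Γ Δ} → ρ ≗ᴿ σ → ext {t = t} ρ ≗ᴿ ext σ
ext-cong e here      = refl
ext-cong e (there x) = cong there (e x)

ext-∘ : (ρ : Ren Δ Θ) (σ : Ren Γ Δ) → ext {t = t} ρ ∘ᴿ ext σ ≗ᴿ ext (ρ ∘ᴿ σ)
ext-∘ ρ σ here      = refl
ext-∘ ρ σ (there x) = refl

ren-cong : {ρ σ : Ren Γ Δ} → ρ ≗ᴿ σ → (φ : Fm Γ) → ren ρ φ ≡ ren σ φ
ren-cong e ⊥'         = refl
ren-cong e (φ ⇒ ψ)    = cong₂ _⇒_ (ren-cong e φ) (ren-cong e ψ)
ren-cong e (∀' s φ)   = cong (∀' s) (ren-cong (ext-cong e) φ)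
ren-cong e (x ≐ y)    = cong₂ _≐_ (e x) (e y)
ren-cong e (app X xs) = cong₂ app (e X) (map-cong e xs)

ren-∘ : (ρ : Ren Δ Θ) (σ : Ren Γ Δ) (φ : Fm Γ) → ren ρ (ren σ φ) ≡ ren (ρ ∘ᴿ σ) φ
ren-∘ ρ σ ⊥'         = refl
ren-∘ ρ σ (φ ⇒ ψ)    = cong₂ _⇒_ (ren-∘ ρ σ φ) (ren-∘ ρ σ ψ)
ren-∘ ρ σ (∀' s φ)   = cong (∀' s) (trans (ren-∘ (ext ρ) (ext σ) φ) (ren-cong (ext-∘ ρ σ) φ))
ren-∘ ρ σ (x ≐ y)    = refl
ren-∘ ρ σ (app X xs) = cong (app (ρ (σ X))) (sym (map-∘ ρ σ xs))

ren-id : (φ : Fm Γ) → ren (λ x → x) φ ≡ φ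
ren-id ⊥'         = refl
ren-id (φ ⇒ ψ)    = cong₂ _⇒_ (ren-id φ) (ren-id ψ)
ren-id (∀' s φ)   = cong (∀' s) (trans (ren-cong (λ { here → refl ; (there x) → refl }) φ) (ren-id φ))
ren-id (x ≐ y)    = refl
ren-id (app X xs) = cong (app X) (map-id xs)

ren-≗id : {ρ : Ren Γ Γ} → ρ ≗ᴿ (λ x → x) → (φ : Fm Γ) → ren ρ φ ≡ φ
ren-≗id e φ = trans (ren-cong e φ) (ren-id φ)

ren-∘-≗ : (ρ : Ren Δ Θ) (σ : Ren Γ Δ) {τ : Ren Γ Θ} → ρ ∘ᴿ σ ≗ᴿ τ →
  (φ : Fm Γ) → ren ρ (ren σ φ) ≡ ren τ φ
ren-∘-≗ ρ σ e φ = trans (ren-∘ ρ σ φ) (ren-cong e φ)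

ren-square : {ρ : Ren Δ Θ} {σ : Ren Γ Δ} {σ′ : Ren Δ′ Θ} {ρ′ : Ren Γ Δ′} →
  ρ ∘ᴿ σ ≗ᴿ σ′ ∘ᴿ ρ′ → (φ : Fm Γ) → ren ρ (ren σ φ) ≡ ren σ′ (ren ρ′ φ)
ren-square {ρ = ρ} {σ} {σ′} {ρ′} e φ = trans (ren-∘-≗ ρ σ e φ) (sym (ren-∘ σ′ ρ′ φ))

ren-wk : (ρ : Ren Γ Δ) (φ : Fm Γ) → ren (ext {t = s} ρ) (wk φ) ≡ wk (ren ρ φ)
ren-wk ρ = ren-square (λ x → refl)

ren-inst : (ρ : Ren Γ Δ) (φ : Fm (s ∷ Γ)) (v : Γ ∋ s) →
  ren ρ (inst φ v) ≡ inst (ren (ext ρ) φ) (ρ v)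
ren-inst ρ φ v = ren-square (λ { here → refl ; (there x) → refl }) φ

inst-ext-wk : (φ : Fm (s ∷ Γ)) → inst (ren (ext there) φ) here ≡ φ
inst-ext-wk φ = trans (ren-∘-≗ _ _ (λ { here → refl ; (there x) → refl }) φ) (ren-id φ)

liftR-cong : (Ψ : Ctx) {ρ σ : Ren Γ Δ} → ρ ≗ᴿ σ → liftR Ψ ρ ≗ᴿ liftR Ψ σ
liftR-cong []      e x = e x
liftR-cong (_ ∷ Ψ) e x = ext-cong (liftR-cong Ψ e) x

liftR-id : (Ψ : Ctx) → liftR {Γ} Ψ (λ x → x) ≗ᴿ (λ x → x)
liftR-id []      x         = refl
liftR-id (_ ∷ Ψ) here      = refl
liftR-id (_ ∷ Ψ) (there x) = cong there (liftR-id Ψ x)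

liftR-∘ : (Ψ : Ctx) (ρ : Ren Δ Θ) (σ : Ren Γ Δ) → liftR Ψ ρ ∘ᴿ liftR Ψ σ ≗ᴿ liftR Ψ (ρ ∘ᴿ σ)
liftR-∘ []      ρ σ x         = refl
liftR-∘ (_ ∷ Ψ) ρ σ here      = refl
liftR-∘ (_ ∷ Ψ) ρ σ (there x) = cong there (liftR-∘ Ψ ρ σ x)

liftR-square : (Ψ : Ctx) {ρ : Ren Δ Θ} {σ : Ren Γ Δ} {σ′ : Ren Δ′ Θ} {ρ′ : Ren Γ Δ′} →
  ρ ∘ᴿ σ ≗ᴿ σ′ ∘ᴿ ρ′ → liftR Ψ ρ ∘ᴿ liftR Ψ σ ≗ᴿ liftR Ψ σ′ ∘ᴿ liftR Ψ ρ′
liftR-square Ψ e x = trans (liftR-∘ Ψ _ _ x) (trans (liftR-cong Ψ e x) (sym (liftR-∘ Ψ _ _ x)))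

liftR-wkR : (Ψ : Ctx) (ρ : Ren Γ Δ) → liftR Ψ ρ ∘ᴿ wkR Ψ ≗ᴿ wkR Ψ ∘ᴿ ρ
liftR-wkR []      ρ x = refl
liftR-wkR (_ ∷ Ψ) ρ x = cong there (liftR-wkR Ψ ρ x)

Tuple : Ctx → ℕ → Set
Tuple Γ k = Vec (Γ ∋ 0) k

↑ᵛ : (j : ℕ) → Γ ∋ s → (ι^ j ++ Γ) ∋ s
↑ᵛ j = wkR (ι^ j)

↑ᵗ : (j : ℕ) → Tuple Γ k → Tuple (ι^ j ++ Γ) k
↑ᵗ j = V.map (wkR (ι^ j))

↑ᶠ : (j : ℕ) → Fm Γ → Fm (ι^ j ++ Γ)
↑ᶠ j = ren (wkR (ι^ j))

-- tup k lists the block with its innermost (last bound) variable last, so here ↦ V.last ys.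
inst⃗ : Tuple Δ k → Ren (ι^ k ++ Δ) Δ
inst⃗ {k = zero}  ys x         = x
inst⃗ {k = suc k} ys here      = V.last ys
inst⃗ {k = suc k} ys (there x) = inst⃗ (V.init ys) x

infix 8 _⟦_⟧
_⟦_⟧ : Fm (ι^ k ++ Δ) → Tuple Δ k → Fm Δ
φ ⟦ ys ⟧ = ren (inst⃗ ys) φ

inst⃗-step : (ys : Tuple Δ (suc k)) → sub1 (V.last ys) ∘ᴿ ext (inst⃗ (V.init ys)) ≗ᴿ inst⃗ ys
inst⃗-step ys here      = refl
inst⃗-step ys (there x) = refl

inst⃗-↑ᵛ : (ys : Tuple Δ k) → inst⃗ ys ∘ᴿ ↑ᵛ k ≗ᴿ (λ x → x)
inst⃗-↑ᵛ {k = zero}  ys x = refl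
inst⃗-↑ᵛ {k = suc k} ys x = inst⃗-↑ᵛ (V.init ys) x

map-inst⃗-↑ᵗ : (ys : Tuple Δ k) (xs : Tuple Δ j) → V.map (inst⃗ ys) (↑ᵗ k xs) ≡ xs
map-inst⃗-↑ᵗ ys xs = trans (sym (map-∘ _ _ xs)) (trans (map-cong (inst⃗-↑ᵛ ys) xs) (map-id xs))

map-inst⃗-tup : (ys : Tuple Δ k) → V.map (inst⃗ ys) (tup k) ≡ ys
map-inst⃗-tup {k = zero}  [] = refl
map-inst⃗-tup {k = suc k} ys = begin
  V.map (inst⃗ ys) (V.map there (tup k) ∷ʳ here)     ≡⟨ map-∷ʳ (inst⃗ ys) here (V.map there (tup k)) ⟩
  V.map (inst⃗ ys) (V.map there (tup k)) ∷ʳ V.last ys ≡⟨ cong (_∷ʳ V.last ys) (sym (map-∘ _ there (tup k))) ⟩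
  V.map (inst⃗ (V.init ys)) (tup k) ∷ʳ V.last ys      ≡⟨ cong (_∷ʳ V.last ys) (map-inst⃗-tup (V.init ys)) ⟩
  V.init ys ∷ʳ V.last ys                              ≡⟨ sym (proj₂ (proj₂ (V.initLast ys))) ⟩
  ys                                                  ∎
  where open ≡-Reasoning

map-liftR-tup : (ρ : Ren Γ Δ) → V.map (liftR (ι^ k) ρ) (tup k) ≡ tup k
map-liftR-tup {k = zero}  ρ = refl
map-liftR-tup {k = suc k} ρ = begin
  V.map (liftR (ι^ (suc k)) ρ) (V.map there (tup k) ∷ʳ here) ≡⟨ map-∷ʳ _ here (V.map there (tup k)) ⟩
  V.map (liftR (ι^ (suc k)) ρ) (V.map there (tup k)) ∷ʳ here ≡⟨ cong (_∷ʳ here) (sym (map-∘ _ there _)) ⟩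
  V.map (there ∘ᴿ liftR (ι^ k) ρ) (tup k) ∷ʳ here            ≡⟨ cong (_∷ʳ here) (map-∘ there _ (tup k)) ⟩
  V.map there (V.map (liftR (ι^ k) ρ) (tup k)) ∷ʳ here       ≡⟨ cong (λ xs → V.map there xs ∷ʳ here)
                                                                     (map-liftR-tup ρ) ⟩
  V.map there (tup k) ∷ʳ here                                ∎
  where open ≡-Reasoning

map-liftR-↑ᵗ : (ρ : Ren Γ Δ) (xs : Tuple Γ j) →
  V.map (liftR (ι^ k) ρ) (↑ᵗ k xs) ≡ ↑ᵗ k (V.map ρ xs)
map-liftR-↑ᵗ ρ xs = trans (sym (map-∘ _ _ xs)) (trans (map-cong (liftR-wkR _ ρ) xs) (map-∘ _ _ xs))

ren-∀ⁿ : (ρ : Ren Γ Δ) (k : ℕ) (φ : Fm (ι^ k ++ Γ)) →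
  ren ρ (∀ⁿ k φ) ≡ ∀ⁿ k (ren (liftR (ι^ k) ρ) φ)
ren-∀ⁿ ρ zero    φ = refl
ren-∀ⁿ ρ (suc k) φ = ren-∀ⁿ ρ k (∀' 0 φ)

ren-∃ⁿ : (ρ : Ren Γ Δ) (k : ℕ) (φ : Fm (ι^ k ++ Γ)) →
  ren ρ (∃ⁿ k φ) ≡ ∃ⁿ k (ren (liftR (ι^ k) ρ) φ)
ren-∃ⁿ ρ zero    φ = refl
ren-∃ⁿ ρ (suc k) φ = ren-∃ⁿ ρ k (∃' 0 φ)

ren-≐⃗ : (ρ : Ren Γ Δ) (xs ys : Tuple Γ k) → ren ρ (xs ≐⃗ ys) ≡ (V.map ρ xs ≐⃗ V.map ρ ys)
ren-≐⃗ ρ []       []       = refl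
ren-≐⃗ ρ (x ∷ xs) (y ∷ ys) = cong (λ e → (ρ x ≐ ρ y) ∧' e) (ren-≐⃗ ρ xs ys)

UniqueAt : (k : ℕ) → Fm (ι^ k ++ Γ) → Tuple Γ k → Fm Γ
UniqueAt k φ zs = ∀ⁿ k (φ ⇒ (tup k ≐⃗ ↑ᵗ k zs))

ren-UniqueAt : (ρ : Ren Γ Δ) (φ : Fm (ι^ k ++ Γ)) (zs : Tuple Γ k) →
  ren ρ (UniqueAt k φ zs) ≡ UniqueAt k (ren (liftR (ι^ k) ρ) φ) (V.map ρ zs)
ren-UniqueAt {k = k} ρ φ zs = trans (ren-∀ⁿ ρ k _) (cong (λ e → ∀ⁿ k (ren (liftR (ι^ k) ρ) φ ⇒ e))
  (trans (ren-≐⃗ _ (tup k) (↑ᵗ k zs)) (cong₂ _≐⃗_ (map-liftR-tup ρ) (map-liftR-↑ᵗ ρ zs))))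

ren-∃!!ⁿ : (ρ : Ren Γ Δ) (k : ℕ) (φ : Fm (ι^ k ++ Γ)) →
  ren ρ (∃!!ⁿ k φ) ≡ ∃!!ⁿ k (ren (liftR (ι^ k) ρ) φ)
ren-∃!!ⁿ ρ k φ = trans (ren-∃ⁿ ρ k _) (cong (λ u → ∃ⁿ k (ren (liftR (ι^ k) ρ) φ ∧' u))
  (trans (ren-UniqueAt (liftR (ι^ k) ρ) (ren (liftR (ι^ k) (↑ᵛ k)) φ) (tup k))
         (cong₂ (UniqueAt k) (ren-square (liftR-square (ι^ k) (liftR-wkR (ι^ k) ρ)) φ)
                             (map-liftR-tup ρ))))

Occ-∃ⁿ : (k : ℕ) {v : Γ ∋ s} {φ : Fm (ι^ k ++ Γ)} → Occ (↑ᵛ k v) φ → Occ v (∃ⁿ k φ)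
Occ-∃ⁿ zero    o = o
Occ-∃ⁿ (suc k) o = Occ-∃ⁿ k (occ⇒ˡ (occ∀ (occ⇒ˡ o)))

Occ-∀ⁿ : (k : ℕ) {v : Γ ∋ s} {φ : Fm (ι^ k ++ Γ)} → Occ (↑ᵛ k v) φ → Occ v (∀ⁿ k φ)
Occ-∀ⁿ zero    o = o
Occ-∀ⁿ (suc k) o = Occ-∀ⁿ k (occ∀ o)

Occ-∧ˡ : {v : Γ ∋ s} → Occ v φ → Occ v (φ ∧' ψ)
Occ-∧ˡ o = occ⇒ˡ (occ⇒ˡ o)

Occ-∧ʳ : {v : Γ ∋ s} → Occ v ψ → Occ v (φ ∧' ψ)
Occ-∧ʳ o = occ⇒ˡ (occ⇒ʳ (occ⇒ˡ o))

Occ-⇔ˡ : {v : Γ ∋ s} → Occ v φ → Occ v (φ ⇔ ψ)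
Occ-⇔ˡ o = Occ-∧ˡ (occ⇒ˡ o)

app⃗ : Γ ∋ suc k → Fm (ι^ (suc k) ++ Γ)
app⃗ {k = k} c = app (↑ᵛ (suc k) c) (tup (suc k))

ren-app⃗ : (ρ : Ren Γ Δ) (c : Γ ∋ suc k) → ren (liftR (ι^ (suc k)) ρ) (app⃗ c) ≡ app⃗ (ρ c)
ren-app⃗ ρ c = cong₂ app (liftR-wkR _ ρ c) (map-liftR-tup ρ)

inst-app⃗ : (c : Γ ∋ suc k) (zs : Tuple Γ (suc k)) → app⃗ c ⟦ zs ⟧ ≡ app c zs
inst-app⃗ c zs = cong₂ app (inst⃗-↑ᵛ zs c) (map-inst⃗-tup zs)

Inhabited : Γ ∋ suc k → Fm Γ
Inhabited {k = k} c = ∃ⁿ (suc k) (app⃗ c)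

Disjoint : Γ ∋ suc k → Γ ∋ suc k → Fm Γ
Disjoint {k = k} c₁ c₂ = ¬' (∃ⁿ (suc k) (app⃗ c₁ ∧' app⃗ c₂))

Coextensive : Γ ∋ suc k → Γ ∋ suc k → Fm Γ
Coextensive {k = k} c₁ c₂ = ∀ⁿ (suc k) (app⃗ c₁ ⇔ app⃗ c₂)

MeetsOnce : Γ ∋ suc k → Γ ∋ suc k → Fm Γ
MeetsOnce {k = k} c d = ∃!!ⁿ (suc k) (app⃗ c ∧' app⃗ d)

OnlyCommon : Γ ∋ suc k → Γ ∋ suc k → Tuple Γ (suc k) → Fm Γ
OnlyCommon {k = k} c d zs = UniqueAt (suc k) (app⃗ c ∧' app⃗ d) zs

ren-Inhabited : (ρ : Ren Γ Δ) (c : Γ ∋ suc k) → ren ρ (Inhabited c) ≡ Inhabited (ρ c)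
ren-Inhabited {k = k} ρ c = trans (ren-∃ⁿ ρ (suc k) _) (cong (∃ⁿ (suc k)) (ren-app⃗ ρ c))

ren-Disjoint : (ρ : Ren Γ Δ) (c₁ c₂ : Γ ∋ suc k) →
  ren ρ (Disjoint c₁ c₂) ≡ Disjoint (ρ c₁) (ρ c₂)
ren-Disjoint {k = k} ρ c₁ c₂ = cong ¬' (trans (ren-∃ⁿ ρ (suc k) _)
  (cong (∃ⁿ (suc k)) (cong₂ _∧'_ (ren-app⃗ ρ c₁) (ren-app⃗ ρ c₂))))

ren-Coextensive : (ρ : Ren Γ Δ) (c₁ c₂ : Γ ∋ suc k) →
  ren ρ (Coextensive c₁ c₂) ≡ Coextensive (ρ c₁) (ρ c₂)
ren-Coextensive {k = k} ρ c₁ c₂ = trans (ren-∀ⁿ ρ (suc k) _)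
  (cong (∀ⁿ (suc k)) (cong₂ _⇔_ (ren-app⃗ ρ c₁) (ren-app⃗ ρ c₂)))

ren-≠' : (ρ : Ren Γ Δ) (c₁ c₂ : Γ ∋ suc k) → ren ρ (c₁ ≠' c₂) ≡ (ρ c₁ ≠' ρ c₂)
ren-≠' ρ c₁ c₂ = cong ¬' (ren-Coextensive ρ c₁ c₂)

ren-MeetsOnce : (ρ : Ren Γ Δ) (c d : Γ ∋ suc k) → ren ρ (MeetsOnce c d) ≡ MeetsOnce (ρ c) (ρ d)
ren-MeetsOnce {k = k} ρ c d = trans (ren-∃!!ⁿ ρ (suc k) _)
  (cong (∃!!ⁿ (suc k)) (cong₂ _∧'_ (ren-app⃗ ρ c) (ren-app⃗ ρ d)))

ren-OnlyCommon : (ρ : Ren Γ Δ) (c d : Γ ∋ suc k) (zs : Tuple Γ (suc k)) →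
  ren ρ (OnlyCommon c d zs) ≡ OnlyCommon (ρ c) (ρ d) (V.map ρ zs)
ren-OnlyCommon ρ c d zs = trans (ren-UniqueAt ρ _ zs)
  (cong (λ φ → UniqueAt _ φ (V.map ρ zs)) (cong₂ _∧'_ (ren-app⃗ ρ c) (ren-app⃗ ρ d)))

-- Closure of derivations under renaming

-- choice* renames H by two renamings local to Defs; ren-lift only needs their action on variables.
ren-choice* : (ρ : Ren Γ Δ) (H : Fm (suc k ∷ Γ)) → ren ρ (choice* k H) ≡ choice* k (ren (ext ρ) H)
ren-choice* {Γ = Γ} {Δ = Δ} {k = k} ρ H = cong₃ (λ h₁ h₂ c → (h₁ ∧' h₂) ⇒ c)
  (cong (λ e → ∀' K (ren (ext ρ) H ⇒ e)) (ren-Inhabited (ext ρ) here))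
  (cong₂ (λ a e → ∀' K (∀' K (a ⇒ e)))
    (cong₃ (λ h₁ h₂ e → h₁ ∧' h₂ ∧' e)
      (ren-lift λ { here → refl ; (there x) → refl })
      (ren-lift λ { here → refl ; (there x) → refl })
      (ren-≠' (ext (ext ρ)) (there here) here))
    (ren-Disjoint (ext (ext ρ)) (there here) here))
  (cong (λ e → ∃' K (∀' K e)) (cong₂ _⇒_
    (ren-lift λ { here → refl ; (there x) → refl })
    (ren-MeetsOnce (ext (ext ρ)) here (there here))))
  where
  K = suc k
  ren-lift : {σ : Ren (K ∷ Γ) (K ∷ K ∷ Γ)} {σ′ : Ren (K ∷ Δ) (K ∷ K ∷ Δ)} →
    ext (ext ρ) ∘ᴿ σ ≗ᴿ σ′ ∘ᴿ ext ρ → ren (ext (ext ρ)) (ren σ H) ≡ ren σ′ (ren (ext ρ) H)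
  ren-lift e = ren-square e H

Occ-ren : (ρ : Ren Γ Δ) {v : Γ ∋ s} {φ : Fm Γ} → Occ v φ → Occ (ρ v) (ren ρ φ)
Occ-ren ρ (occ⇒ˡ o)  = occ⇒ˡ (Occ-ren ρ o)
Occ-ren ρ (occ⇒ʳ o)  = occ⇒ʳ (Occ-ren ρ o)
Occ-ren ρ (occ∀ o)   = occ∀ (Occ-ren (ext ρ) o)
Occ-ren ρ occ≐ˡ      = occ≐ˡ
Occ-ren ρ occ≐ʳ      = occ≐ʳ
Occ-ren ρ occP       = occP
Occ-ren ρ (occArg i) = occArg (∈-map⁺ ρ i)

RenClosed : Hyps → Set
RenClosed G = ∀ {Γ Δ} (ρ : Ren Γ Δ) {φ} → G Γ φ → G Δ (ren ρ φ)

Choice*-ren : RenClosed (Choice* j)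
Choice*-ren ρ (asser H o) =
  subst (Choice* _ _) (sym (ren-choice* ρ H)) (asser (ren (ext ρ) H) (Occ-ren (ext ρ) o))

Comprehension : (k : ℕ) → Fm (ι^ (suc k) ++ Γ) → Fm Γ
Comprehension k φ = ∃' (suc k) (∀ⁿ (suc k) (app⃗ here ⇔ ren (liftR (ι^ (suc k)) there) φ))

ren-Comprehension : (ρ : Ren Γ Δ) (φ : Fm (ι^ (suc k) ++ Γ)) →
  ren ρ (Comprehension k φ) ≡ Comprehension k (ren (liftR (ι^ (suc k)) ρ) φ)
ren-Comprehension {k = k} ρ φ = cong (∃' (suc k)) (trans (ren-∀ⁿ (ext ρ) (suc k) _)
  (cong (∀ⁿ (suc k)) (cong₂ _⇔_ (ren-app⃗ (ext ρ) here)
                                (ren-square (liftR-square (ι^ (suc k)) λ _ → refl) φ))))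

ren-Der : {G : Hyps} → RenClosed G → (ρ : Ren Γ Δ) {φ : Fm Γ} → Der G Γ φ → Der G Δ (ren ρ φ)
ren-Der G-ren ρ (hyp g)          = hyp (G-ren ρ g)
ren-Der G-ren ρ (ax-K φ ψ)       = ax-K _ _
ren-Der G-ren ρ (ax-S φ ψ χ)     = ax-S _ _ _
ren-Der G-ren ρ (ax-DN φ)        = ax-DN _
ren-Der G-ren ρ (ax-inst φ v)    =
  subst (λ e → Der _ _ (∀' _ (ren (ext ρ) φ) ⇒ e)) (sym (ren-inst ρ φ v)) (ax-inst (ren (ext ρ) φ) (ρ v))
ren-Der G-ren ρ (ax-dist φ ψ)    = ax-dist _ _
ren-Der G-ren ρ (ax-vac φ ψ)     =
  subst (λ e → Der _ _ (∀' _ (e ⇒ ren (ext ρ) ψ) ⇒ ren ρ φ ⇒ ∀' _ (ren (ext ρ) ψ))) (sym (ren-wk ρ φ))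
    (ax-vac (ren ρ φ) (ren (ext ρ) ψ))
ren-Der G-ren ρ (ax-refl x)      = ax-refl (ρ x)
ren-Der G-ren ρ (ax-subst φ x y) =
  subst₂ (λ a b → Der _ _ (ρ x ≐ ρ y ⇒ a ⇒ b)) (sym (ren-inst ρ φ x)) (sym (ren-inst ρ φ y))
    (ax-subst (ren (ext ρ) φ) (ρ x) (ρ y))
ren-Der G-ren ρ (ax-comp k φ)    =
  subst (Der _ _) (sym (ren-Comprehension ρ φ)) (ax-comp k (ren (liftR (ι^ (suc k)) ρ) φ))
ren-Der G-ren ρ (mp d e)         = mp (ren-Der G-ren ρ d) (ren-Der G-ren ρ e)
ren-Der G-ren ρ (gen d)          = gen (ren-Der G-ren (ext ρ) d)
ren-Der G-ren ρ (str {φ = φ} d)  = str (subst (Der _ _) (ren-wk ρ φ) (ren-Der G-ren (ext ρ) d))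

-- Natural deduction

infixr 4 _⇛_
_⇛_ : List (Fm Γ) → Fm Γ → Fm Γ
[]       ⇛ ψ = ψ
(φ ∷ Φs) ⇛ ψ = Φs ⇛ (φ ⇒ ψ)

ren-⇛ : (ρ : Ren Γ Δ) (Φs : List (Fm Γ)) (ψ : Fm Γ) →
  ren ρ (Φs ⇛ ψ) ≡ (L.map (ren ρ) Φs ⇛ ren ρ ψ)
ren-⇛ ρ []       ψ = refl
ren-⇛ ρ (φ ∷ Φs) ψ = ren-⇛ ρ Φs (φ ⇒ ψ)

module Deduction (G : Hyps) where

  -- A record rather than Der G Γ (Φs ⇛ ψ) itself, so that Φs and ψ remain inferable.
  infix 2 _⊩_
  record _⊩_ (Φs : List (Fm Γ)) (ψ : Fm Γ) : Set where
    constructor ⟨_⟩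
    field derivation : Der G Γ (Φs ⇛ ψ)
  open _⊩_ public

  recast : φ ≡ ψ → Φs ⊩ φ → Φs ⊩ ψ
  recast refl d = d

  recastₗ : {Ψs : List (Fm Γ)} → Φs ≡ Ψs → Φs ⊩ φ → Ψs ⊩ φ
  recastₗ refl d = d

  ⊢-id : (φ : Fm Γ) → Der G Γ (φ ⇒ φ)
  ⊢-id φ = mp (mp (ax-S φ (φ ⇒ φ) φ) (ax-K φ (φ ⇒ φ))) (ax-K φ φ)

  ⊢-const : (Φs : List (Fm Γ)) → Der G Γ ψ → Der G Γ (Φs ⇛ ψ)
  ⊢-const []                 d = d
  ⊢-const {ψ = ψ} (φ ∷ Φs) d = ⊢-const Φs (mp (ax-K ψ φ) d)

  ⊢-mp : (Φs : List (Fm Γ)) → Der G Γ (Φs ⇛ (φ ⇒ ψ)) → Der G Γ (Φs ⇛ φ) → Der G Γ (Φs ⇛ ψ)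
  ⊢-mp []                         f a = mp f a
  ⊢-mp {φ = φ} {ψ = ψ} (χ ∷ Φs) f a = ⊢-mp Φs (⊢-mp Φs (⊢-const Φs (ax-S χ φ ψ)) f) a

  axiom : Der G Γ ψ → Φs ⊩ ψ
  axiom {Φs = Φs} d = ⟨ ⊢-const Φs d ⟩

  ⇒E : Φs ⊩ (φ ⇒ ψ) → Φs ⊩ φ → Φs ⊩ ψ
  ⇒E {Φs = Φs} ⟨ f ⟩ ⟨ a ⟩ = ⟨ ⊢-mp Φs f a ⟩

  ⇒I : (φ ∷ Φs) ⊩ ψ → Φs ⊩ (φ ⇒ ψ)
  ⇒I ⟨ d ⟩ = ⟨ d ⟩

  ⇒I⁻¹ : Φs ⊩ (φ ⇒ ψ) → (φ ∷ Φs) ⊩ ψ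
  ⇒I⁻¹ ⟨ d ⟩ = ⟨ d ⟩

  #0 : (φ ∷ Φs) ⊩ φ
  #0 {φ = φ} {Φs = Φs} = ⟨ ⊢-const Φs (⊢-id φ) ⟩

  skip : Φs ⊩ ψ → (φ ∷ Φs) ⊩ ψ
  skip {ψ = ψ} {φ = φ} d = ⇒I⁻¹ (⇒E (axiom (ax-K ψ φ)) d)

  #1 : (ψ ∷ φ ∷ Φs) ⊩ φ
  #1 = skip #0

  skip₁ : (ψ ∷ Φs) ⊩ χ → (ψ ∷ φ ∷ Φs) ⊩ χ
  skip₁ d = ⇒I⁻¹ (skip (⇒I d))

  byContradiction : (¬' φ ∷ Φs) ⊩ ⊥' → Φs ⊩ φ
  byContradiction {φ = φ} d = ⇒E (axiom (ax-DN φ)) (⇒I d)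

  ⊤I : Φs ⊩ ⊤'
  ⊤I = ⇒I #0

  ∧I : Φs ⊩ φ → Φs ⊩ ψ → Φs ⊩ (φ ∧' ψ)
  ∧I a b = ⇒I (⇒E (⇒E #0 (skip a)) (skip b))

  ∧E₁ : Φs ⊩ (φ ∧' ψ) → Φs ⊩ φ
  ∧E₁ d = byContradiction (⇒E (skip d) (⇒I (⇒I (⇒E (skip #1) #1))))

  ∧E₂ : Φs ⊩ (φ ∧' ψ) → Φs ⊩ ψ
  ∧E₂ d = byContradiction (⇒E (skip d) (⇒I (skip #0)))

  ⇔I : (φ ∷ Φs) ⊩ ψ → (ψ ∷ Φs) ⊩ φ → Φs ⊩ (φ ⇔ ψ)
  ⇔I a b = ∧I (⇒I a) (⇒I b)

  ⇔E₁ : Φs ⊩ (φ ⇔ ψ) → Φs ⊩ φ → Φs ⊩ ψ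
  ⇔E₁ d = ⇒E (∧E₁ d)

  ⇔E₂ : Φs ⊩ (φ ⇔ ψ) → Φs ⊩ ψ → Φs ⊩ φ
  ⇔E₂ d = ⇒E (∧E₂ d)

  ∀I : {φ : Fm (s ∷ Γ)} → L.map wk Φs ⊩ φ → Φs ⊩ ∀' s φ
  ∀I {Φs = Φs} ⟨ d ⟩ = generalise Φs (gen d)
    where
    generalise : ∀ {Γ s} (Φs : List (Fm Γ)) {φ : Fm (s ∷ Γ)} →
      Der G Γ (∀' s (L.map wk Φs ⇛ φ)) → Φs ⊩ ∀' s φ
    generalise []             d = ⟨ d ⟩
    generalise (χ ∷ Φs) {φ} d = ⇒I⁻¹ (⇒E (axiom (ax-vac χ φ)) (generalise Φs d))

  ∀E : {φ : Fm (s ∷ Γ)} → Φs ⊩ ∀' s φ → (v : Γ ∋ s) → Φs ⊩ inst φ v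
  ∀E {φ = φ} d v = ⇒E (axiom (ax-inst φ v)) d

  ∃I : {φ : Fm (s ∷ Γ)} (v : Γ ∋ s) → Φs ⊩ inst φ v → Φs ⊩ ∃' s φ
  ∃I v d = ⇒I (⇒E (∀E #0 v) (skip d))

  ∃E : {φ : Fm (s ∷ Γ)} → Φs ⊩ ∃' s φ → (φ ∷ L.map wk Φs) ⊩ wk ψ → Φs ⊩ ψ
  ∃E d e = byContradiction (⇒E (skip d) (∀I (⇒I (⇒E #1 (skip₁ e)))))

↑ˡ : (k : ℕ) → List (Fm Γ) → List (Fm (ι^ k ++ Γ))
↑ˡ k = L.map (↑ᶠ k)

↑ᶠ-zero : (φ : Fm Γ) → ↑ᶠ 0 φ ≡ φ
↑ᶠ-zero = ren-≗id λ _ → refl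

↑ᶠ-suc : (k : ℕ) (φ : Fm Γ) → wk (↑ᶠ k φ) ≡ ↑ᶠ (suc k) φ
↑ᶠ-suc k = ren-∘-≗ _ _ λ _ → refl

↑ˡ-zero : (Φs : List (Fm Γ)) → ↑ˡ 0 Φs ≡ Φs
↑ˡ-zero Φs = trans (Listₚ.map-cong ↑ᶠ-zero Φs) (Listₚ.map-id Φs)

↑ˡ-suc : (k : ℕ) (Φs : List (Fm Γ)) → L.map wk (↑ˡ k Φs) ≡ ↑ˡ (suc k) Φs
↑ˡ-suc k Φs = trans (sym (Listₚ.map-∘ Φs)) (Listₚ.map-cong (↑ᶠ-suc k) Φs)

module Blocks {G : Hyps} (G-ren : RenClosed G) where
  open Deduction G public

  ren-⊩ : (ρ : Ren Γ Δ) → Φs ⊩ φ → L.map (ren ρ) Φs ⊩ ren ρ φ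
  ren-⊩ {Φs = Φs} {φ = φ} ρ ⟨ d ⟩ = ⟨ subst (Der G _) (ren-⇛ ρ Φs φ) (ren-Der G-ren ρ d) ⟩

  ↑⊩ : (k : ℕ) → Φs ⊩ φ → ↑ˡ k Φs ⊩ ↑ᶠ k φ
  ↑⊩ k = ren-⊩ (wkR (ι^ k))

  ↑⊩₁ : (k : ℕ) {ψ χ : Fm (ι^ k ++ Γ)} → ↑ᶠ k φ ≡ ψ → Φs ⊩ φ → (χ ∷ ↑ˡ k Φs) ⊩ ψ
  ↑⊩₁ k eq d = skip (recast eq (↑⊩ k d))

  ↑⊩₂ : (k : ℕ) {ψ χ χ′ : Fm (ι^ k ++ Γ)} →
    ↑ᶠ k φ ≡ ψ → Φs ⊩ φ → (χ ∷ χ′ ∷ ↑ˡ k Φs) ⊩ ψ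
  ↑⊩₂ k eq d = skip (↑⊩₁ k eq d)

  ∃ⁿI : {φ : Fm (ι^ k ++ Γ)} (ys : Tuple Γ k) → Φs ⊩ φ ⟦ ys ⟧ → Φs ⊩ ∃ⁿ k φ
  ∃ⁿI {k = zero}  {φ = φ} ys d = recast (ren-≗id (λ _ → refl) φ) d
  ∃ⁿI {k = suc k} {φ = φ} ys d =
    ∃ⁿI (V.init ys) (∃I (V.last ys) (recast (sym (ren-∘-≗ _ _ (inst⃗-step ys) φ)) d))

  ∀ⁿE : {φ : Fm (ι^ k ++ Γ)} → Φs ⊩ ∀ⁿ k φ → (ys : Tuple Γ k) → Φs ⊩ φ ⟦ ys ⟧
  ∀ⁿE {k = zero}  {φ = φ} d ys = recast (sym (ren-≗id (λ _ → refl) φ)) d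
  ∀ⁿE {k = suc k} {φ = φ} d ys =
    recast (ren-∘-≗ _ _ (inst⃗-step ys) φ) (∀E (∀ⁿE d (V.init ys)) (V.last ys))

  ∀ⁿI : {φ : Fm (ι^ k ++ Γ)} → ↑ˡ k Φs ⊩ φ → Φs ⊩ ∀ⁿ k φ
  ∀ⁿI {k = zero}  {Φs = Φs} d = recastₗ (↑ˡ-zero Φs) d
  ∀ⁿI {k = suc k} {Φs = Φs} d = ∀ⁿI (∀I (recastₗ (sym (↑ˡ-suc k Φs)) d))

  ∃ⁿE : {φ : Fm (ι^ k ++ Γ)} → Φs ⊩ ∃ⁿ k φ → (φ ∷ ↑ˡ k Φs) ⊩ ↑ᶠ k ψ → Φs ⊩ ψ
  ∃ⁿE {k = zero}  {Φs = Φs} {ψ = ψ} d e =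
    ⇒E (⇒I (recast (↑ᶠ-zero ψ) (recastₗ (cong (_ ∷_) (↑ˡ-zero Φs)) e))) d
  ∃ⁿE {k = suc k} {Φs = Φs} {ψ = ψ} d e =
    ∃ⁿE d (∃E #0 (skip₁ (recast (sym (↑ᶠ-suc k ψ)) (recastₗ (cong (_ ∷_) (sym (↑ˡ-suc k Φs))) e))))

  ∃ⁿE₂ : {φ₁ φ₂ : Fm (ι^ k ++ Γ)} → Φs ⊩ ∃ⁿ k (φ₁ ∧' φ₂) →
    (φ₁ ∷ φ₂ ∷ ↑ˡ k Φs) ⊩ ↑ᶠ k ψ → Φs ⊩ ψ
  ∃ⁿE₂ d e = ∃ⁿE d (⇒E (⇒E (skip (⇒I (⇒I e))) (∧E₂ #0)) (∧E₁ #0))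

  ≐-sym : {x y : Γ ∋ 0} → Φs ⊩ x ≐ y → Φs ⊩ y ≐ x
  ≐-sym {x = x} {y} d = ⇒E (⇒E (axiom (ax-subst (here ≐ there x) x y)) d) (axiom (ax-refl x))

  ≐-trans : {x y z : Γ ∋ 0} → Φs ⊩ x ≐ y → Φs ⊩ y ≐ z → Φs ⊩ x ≐ z
  ≐-trans {x = x} {y} {z} d e = ⇒E (⇒E (axiom (ax-subst (there x ≐ here) y z)) e) d

  -- _≐⃗_ is not injective; this judgment keeps the two tuples inferable.
  infix 2 _⊩_≋_
  record _⊩_≋_ (Φs : List (Fm Γ)) (xs ys : Tuple Γ k) : Set where
    constructor ≋⟨_⟩
    field ≋-derivation : Φs ⊩ xs ≐⃗ ys

  ≋-cons : {x y : Γ ∋ 0} {xs ys : Tuple Γ k} →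
    Φs ⊩ x ≐ y → Φs ⊩ xs ≋ ys → Φs ⊩ (x ∷ xs) ≋ (y ∷ ys)
  ≋-cons d ≋⟨ e ⟩ = ≋⟨ ∧I d e ⟩

  ≋-head : {x y : Γ ∋ 0} {xs ys : Tuple Γ k} → Φs ⊩ (x ∷ xs) ≋ (y ∷ ys) → Φs ⊩ x ≐ y
  ≋-head ≋⟨ d ⟩ = ∧E₁ d

  ≋-tail : {x y : Γ ∋ 0} {xs ys : Tuple Γ k} → Φs ⊩ (x ∷ xs) ≋ (y ∷ ys) → Φs ⊩ xs ≋ ys
  ≋-tail ≋⟨ d ⟩ = ≋⟨ ∧E₂ d ⟩

  ≋-refl : {xs : Tuple Γ k} → Φs ⊩ xs ≋ xs
  ≋-refl {xs = []}     = ≋⟨ ⊤I ⟩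
  ≋-refl {xs = x ∷ xs} = ≋-cons (axiom (ax-refl x)) ≋-refl

  ≋-sym : {xs ys : Tuple Γ k} → Φs ⊩ xs ≋ ys → Φs ⊩ ys ≋ xs
  ≋-sym {xs = []}    {[]}    d = ≋-refl
  ≋-sym {xs = _ ∷ _} {_ ∷ _} d = ≋-cons (≐-sym (≋-head d)) (≋-sym (≋-tail d))

  ≋-trans : {xs ys zs : Tuple Γ k} → Φs ⊩ xs ≋ ys → Φs ⊩ ys ≋ zs → Φs ⊩ xs ≋ zs
  ≋-trans {xs = []}    {[]}    {[]}    d e = ≋-refl
  ≋-trans {xs = _ ∷ _} {_ ∷ _} {_ ∷ _} d e =
    ≋-cons (≐-trans (≋-head d) (≋-head e)) (≋-trans (≋-tail d) (≋-tail e))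

  ≋-++ˡ : {xs xs′ : Tuple Γ j} (ys ys′ : Tuple Γ k) →
    Φs ⊩ (xs V.++ ys) ≋ (xs′ V.++ ys′) → Φs ⊩ xs ≋ xs′
  ≋-++ˡ {xs = []}    {[]}    ys ys′ d = ≋-refl
  ≋-++ˡ {xs = _ ∷ _} {_ ∷ _} ys ys′ d = ≋-cons (≋-head d) (≋-++ˡ ys ys′ (≋-tail d))

  ≋-++ʳ : (xs xs′ : Tuple Γ j) {ys ys′ : Tuple Γ k} →
    Φs ⊩ (xs V.++ ys) ≋ (xs′ V.++ ys′) → Φs ⊩ ys ≋ ys′
  ≋-++ʳ []       []        d = d
  ≋-++ʳ (_ ∷ xs) (_ ∷ xs′) d = ≋-++ʳ xs xs′ (≋-tail d)

  ≋-init : {xs ys : Tuple Γ (suc k)} → Φs ⊩ xs ≋ ys → Φs ⊩ V.init xs ≋ V.init ys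
  ≋-init {xs = _ ∷ []}    {_ ∷ []}    d = ≋-refl
  ≋-init {xs = _ ∷ _ ∷ _} {_ ∷ _ ∷ _} d = ≋-cons (≋-head d) (≋-init (≋-tail d))

  ≋-last : {xs ys : Tuple Γ (suc k)} → Φs ⊩ xs ≋ ys → Φs ⊩ V.last xs ≐ V.last ys
  ≋-last {xs = _ ∷ []}    {_ ∷ []}    d = ≋-head d
  ≋-last {xs = _ ∷ _ ∷ _} {_ ∷ _ ∷ _} d = ≋-last (≋-tail d)

  skip≋ : {xs ys : Tuple Γ k} → Φs ⊩ xs ≋ ys → (φ ∷ Φs) ⊩ xs ≋ ys
  skip≋ ≋⟨ d ⟩ = ≋⟨ skip d ⟩

  ↑≋ : (j : ℕ) {xs ys : Tuple Γ k} → Φs ⊩ xs ≋ ys → ↑ˡ j Φs ⊩ ↑ᵗ j xs ≋ ↑ᵗ j ys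
  ↑≋ j {xs} {ys} ≋⟨ d ⟩ = ≋⟨ recast (ren-≐⃗ (↑ᵛ j) xs ys) (↑⊩ j d) ⟩

  ↓≋ : (j : ℕ) {Φs : List (Fm (ι^ j ++ Γ))} (xs ys : Tuple Γ k) →
    Φs ⊩ ↑ᵗ j xs ≋ ↑ᵗ j ys → Φs ⊩ ↑ᶠ j (xs ≐⃗ ys)
  ↓≋ j xs ys ≋⟨ d ⟩ = recast (sym (ren-≐⃗ (↑ᵛ j) xs ys)) d

  -- ax-subst rewrites the innermost variable of the block, i.e. the last component.
  ≋-subst : ∀ {Γ k} {Φs : List (Fm Γ)} (φ : Fm (ι^ k ++ Γ)) {xs ys : Tuple Γ k} →
    Φs ⊩ xs ≋ ys → Φs ⊩ φ ⟦ xs ⟧ → Φs ⊩ φ ⟦ ys ⟧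
  ≋-subst {k = zero} φ {[]} {[]} e d = d
  ≋-subst {Γ} {suc k} {Φs} φ {xs} {ys} e d =
    recast (trans (last-set ys) (ren-∘-≗ _ _ (inst⃗-step ys) φ))
      (≋-subst (inst φ (↑ᵛ k (V.last ys))) (≋-init e) (recast (sym (last-set xs)) last-replaced))
    where
    last-set : (zs : Tuple Γ (suc k)) →
      inst φ (↑ᵛ k (V.last ys)) ⟦ V.init zs ⟧ ≡ inst (ren (ext (inst⃗ (V.init zs))) φ) (V.last ys)
    last-set zs = ren-square (λ { here → inst⃗-↑ᵛ (V.init zs) (V.last ys) ; (there x) → refl }) φ
    last-replaced : Φs ⊩ inst (ren (ext (inst⃗ (V.init xs))) φ) (V.last ys)
    last-replaced =
      ⇒E (⇒E (axiom (ax-subst (ren (ext (inst⃗ (V.init xs))) φ) (V.last xs) (V.last ys))) (≋-last e))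
         (recast (sym (ren-∘-≗ _ _ (inst⃗-step xs) φ)) d)

  ≋-app : {P : Γ ∋ suc k} {xs ys : Tuple Γ (suc k)} → Φs ⊩ xs ≋ ys → Φs ⊩ app P xs → Φs ⊩ app P ys
  ≋-app {P = P} {xs} {ys} e d =
    recast (inst-app⃗ P ys) (≋-subst (app⃗ P) e (recast (sym (inst-app⃗ P xs)) d))

  UniqueAt-elim : {φ : Fm (ι^ k ++ Γ)} {zs : Tuple Γ k} → Φs ⊩ UniqueAt k φ zs →
    (ws : Tuple Γ k) → Φs ⊩ φ ⟦ ws ⟧ → Φs ⊩ ws ≋ zs
  UniqueAt-elim {k = k} {zs = zs} d ws w = ≋⟨ recast
    (trans (ren-≐⃗ (inst⃗ ws) (tup k) (↑ᵗ k zs)) (cong₂ _≐⃗_ (map-inst⃗-tup ws) (map-inst⃗-↑ᵗ ws zs)))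
    (⇒E (∀ⁿE d ws) w) ⟩

  ∃!!ⁿI : {φ : Fm (ι^ k ++ Γ)} (ys : Tuple Γ k) → Φs ⊩ φ ⟦ ys ⟧ →
    (φ ∷ ↑ˡ k Φs) ⊩ tup k ≋ ↑ᵗ k ys → Φs ⊩ ∃!!ⁿ k φ
  ∃!!ⁿI {k = k} {φ = φ} ys d ≋⟨ u ⟩ = ∃ⁿI ys (∧I d (recast (sym unique-inst) (∀ⁿI (⇒I u))))
    where
    inst-lift-↑ : liftR (ι^ k) (inst⃗ ys) ∘ᴿ liftR (ι^ k) (↑ᵛ k) ≗ᴿ (λ x → x)
    inst-lift-↑ x =
      trans (liftR-∘ (ι^ k) _ _ x) (trans (liftR-cong (ι^ k) (inst⃗-↑ᵛ ys) x) (liftR-id (ι^ k) x))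
    unique-inst : ren (inst⃗ ys) (UniqueAt k (ren (liftR (ι^ k) (↑ᵛ k)) φ) (tup k)) ≡ UniqueAt k φ ys
    unique-inst = trans (ren-UniqueAt (inst⃗ ys) _ (tup k))
      (cong₂ (UniqueAt k) (trans (ren-∘-≗ _ _ inst-lift-↑ φ) (ren-id φ)) (map-inst⃗-tup ys))

  ∃!!ⁿE : {φ : Fm (ι^ k ++ Γ)} → Φs ⊩ ∃!!ⁿ k φ →
    (φ ∷ UniqueAt k (ren (liftR (ι^ k) (↑ᵛ k)) φ) (tup k) ∷ ↑ˡ k Φs) ⊩ ↑ᶠ k ψ → Φs ⊩ ψ
  ∃!!ⁿE = ∃ⁿE₂

module Fibers (n′ m : ℕ) where

  n K : ℕ
  n = suc n′
  K = n + m

  open Blocks (Choice*-ren {K})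

  app₂ : Δ ∋ K → Tuple Δ n → Tuple Δ m → Fm Δ
  app₂ r xs ys = app r (xs V.++ ys)

  InDom : Δ ∋ K → Tuple Δ n → Fm Δ
  InDom r xs = ∃ⁿ m (app₂ (↑ᵛ m r) (↑ᵗ m xs) (tup m))

  -- IsDom and Selects are the antecedent and the consequent of AC^{n,m}.
  IsDom : Δ ∋ n → Δ ∋ K → Fm Δ
  IsDom a r = ∀ⁿ n (app⃗ a ⇔ InDom (↑ᵛ n r) (tup n))

  SelectsAt : Δ ∋ K → Δ ∋ K → Tuple Δ n → Fm Δ
  SelectsAt r s xs = ∃!!ⁿ m (app₂ (↑ᵛ m r) (↑ᵗ m xs) (tup m) ∧' app₂ (↑ᵛ m s) (↑ᵗ m xs) (tup m))

  Selects : Δ ∋ n → Δ ∋ K → Δ ∋ K → Fm Δ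
  Selects a r s = ∀ⁿ n (app⃗ a ⇒ SelectsAt (↑ᵛ n r) (↑ᵛ n s) (tup n))

  Split : Δ ∋ K → Tuple Δ n → Tuple Δ K → Tuple Δ m → Fm Δ
  Split r xs zs ys = (zs ≐⃗ (xs V.++ ys)) ∧' app r zs

  InFiber : Δ ∋ K → Tuple Δ n → Tuple Δ K → Fm Δ
  InFiber r xs zs = ∃ⁿ m (Split (↑ᵛ m r) (↑ᵗ m xs) (↑ᵗ m zs) (tup m))

  Fiber : Δ ∋ K → Δ ∋ K → Tuple Δ n → Fm Δ
  Fiber c r xs = ∀ⁿ K (app⃗ c ⇔ InFiber (↑ᵛ K r) (↑ᵗ K xs) (tup K))

  IsFiber : Δ ∋ K → Δ ∋ K → Δ ∋ n → Fm Δ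
  IsFiber c r a = ∃ⁿ n (app⃗ a ∧' Fiber (↑ᵛ n c) (↑ᵛ n r) (tup n))

  Candidate : Δ ∋ K → Δ ∋ K → Δ ∋ n → Fm Δ
  Candidate c r a = IsDom a r ∧' IsFiber c r a

  Transversal : Δ ∋ K → Δ ∋ K → Δ ∋ n → Fm Δ
  Transversal d r a = ∀' K (Candidate here (there r) (there a) ⇒ MeetsOnce here (there d))

  ren-app₂ : (ρ : Ren Γ Δ) (r : Γ ∋ K) (xs : Tuple Γ n) (ys : Tuple Γ m) →
    ren ρ (app₂ r xs ys) ≡ app₂ (ρ r) (V.map ρ xs) (V.map ρ ys)
  ren-app₂ ρ r xs ys = cong (app (ρ r)) (map-++ ρ xs ys)

  ren-app₂-↑ : (ρ : Ren Γ Δ) (r : Γ ∋ K) (xs : Tuple Γ n) →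
    ren (liftR (ι^ m) ρ) (app₂ (↑ᵛ m r) (↑ᵗ m xs) (tup m))
      ≡ app₂ (↑ᵛ m (ρ r)) (↑ᵗ m (V.map ρ xs)) (tup m)
  ren-app₂-↑ ρ r xs = trans (ren-app₂ (liftR (ι^ m) ρ) (↑ᵛ m r) (↑ᵗ m xs) (tup m))
    (cong₃ app₂ (liftR-wkR _ ρ r) (map-liftR-↑ᵗ ρ xs) (map-liftR-tup ρ))

  ren-InDom : (ρ : Ren Γ Δ) (r : Γ ∋ K) (xs : Tuple Γ n) → ren ρ (InDom r xs) ≡ InDom (ρ r) (V.map ρ xs)
  ren-InDom ρ r xs = trans (ren-∃ⁿ ρ m _) (cong (∃ⁿ m) (ren-app₂-↑ ρ r xs))

  ren-IsDom : (ρ : Ren Γ Δ) (a : Γ ∋ n) (r : Γ ∋ K) → ren ρ (IsDom a r) ≡ IsDom (ρ a) (ρ r)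
  ren-IsDom ρ a r = trans (ren-∀ⁿ ρ n _) (cong (∀ⁿ n) (cong₂ _⇔_ (ren-app⃗ ρ a)
    (trans (ren-InDom (liftR (ι^ n) ρ) (↑ᵛ n r) (tup n)) (cong₂ InDom (liftR-wkR _ ρ r) (map-liftR-tup ρ)))))

  ren-SelectsAt : (ρ : Ren Γ Δ) (r s : Γ ∋ K) (xs : Tuple Γ n) →
    ren ρ (SelectsAt r s xs) ≡ SelectsAt (ρ r) (ρ s) (V.map ρ xs)
  ren-SelectsAt ρ r s xs = trans (ren-∃!!ⁿ ρ m _)
    (cong (∃!!ⁿ m) (cong₂ _∧'_ (ren-app₂-↑ ρ r xs) (ren-app₂-↑ ρ s xs)))

  ren-Split : (ρ : Ren Γ Δ) (r : Γ ∋ K) (xs : Tuple Γ n) (zs : Tuple Γ K) (ys : Tuple Γ m) →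
    ren ρ (Split r xs zs ys) ≡ Split (ρ r) (V.map ρ xs) (V.map ρ zs) (V.map ρ ys)
  ren-Split ρ r xs zs ys = cong (_∧' app (ρ r) (V.map ρ zs))
    (trans (ren-≐⃗ ρ zs (xs V.++ ys)) (cong (V.map ρ zs ≐⃗_) (map-++ ρ xs ys)))

  ren-InFiber : (ρ : Ren Γ Δ) (r : Γ ∋ K) (xs : Tuple Γ n) (zs : Tuple Γ K) →
    ren ρ (InFiber r xs zs) ≡ InFiber (ρ r) (V.map ρ xs) (V.map ρ zs)
  ren-InFiber ρ r xs zs = trans (ren-∃ⁿ ρ m _) (cong (∃ⁿ m)
    (trans (ren-Split (liftR (ι^ m) ρ) (↑ᵛ m r) (↑ᵗ m xs) (↑ᵗ m zs) (tup m))
           (cong₄ Split (liftR-wkR _ ρ r) (map-liftR-↑ᵗ ρ xs) (map-liftR-↑ᵗ ρ zs) (map-liftR-tup ρ))))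

  ren-Fiber : (ρ : Ren Γ Δ) (c r : Γ ∋ K) (xs : Tuple Γ n) →
    ren ρ (Fiber c r xs) ≡ Fiber (ρ c) (ρ r) (V.map ρ xs)
  ren-Fiber ρ c r xs = trans (ren-∀ⁿ ρ K _) (cong (∀ⁿ K) (cong₂ _⇔_ (ren-app⃗ ρ c)
    (trans (ren-InFiber (liftR (ι^ K) ρ) (↑ᵛ K r) (↑ᵗ K xs) (tup K))
           (cong₃ InFiber (liftR-wkR _ ρ r) (map-liftR-↑ᵗ ρ xs) (map-liftR-tup ρ)))))

  ren-IsFiber : (ρ : Ren Γ Δ) (c r : Γ ∋ K) (a : Γ ∋ n) →
    ren ρ (IsFiber c r a) ≡ IsFiber (ρ c) (ρ r) (ρ a)
  ren-IsFiber ρ c r a = trans (ren-∃ⁿ ρ n _) (cong (∃ⁿ n) (cong₂ _∧'_ (ren-app⃗ ρ a)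
    (trans (ren-Fiber (liftR (ι^ n) ρ) (↑ᵛ n c) (↑ᵛ n r) (tup n))
           (cong₃ Fiber (liftR-wkR _ ρ c) (liftR-wkR _ ρ r) (map-liftR-tup ρ)))))

  ren-Candidate : (ρ : Ren Γ Δ) (c r : Γ ∋ K) (a : Γ ∋ n) →
    ren ρ (Candidate c r a) ≡ Candidate (ρ c) (ρ r) (ρ a)
  ren-Candidate ρ c r a = cong₂ _∧'_ (ren-IsDom ρ a r) (ren-IsFiber ρ c r a)

  ren-Transversal : (ρ : Ren Γ Δ) (d r : Γ ∋ K) (a : Γ ∋ n) →
    ren ρ (Transversal d r a) ≡ Transversal (ρ d) (ρ r) (ρ a)
  ren-Transversal ρ d r a = cong (∀' K) (cong₂ _⇒_ (ren-Candidate (ext ρ) here (there r) (there a))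
                                                   (ren-MeetsOnce (ext ρ) here (there d)))

  InFiber-intro : {r : Δ ∋ K} {xs : Tuple Δ n} {zs : Tuple Δ K} (ys : Tuple Δ m) →
    Φs ⊩ zs ≋ (xs V.++ ys) → Φs ⊩ app r zs → Φs ⊩ InFiber r xs zs
  InFiber-intro {r = r} {xs} {zs} ys ≋⟨ e ⟩ d = ∃ⁿI ys (recast (sym split-inst) (∧I e d))
    where
    split-inst : Split (↑ᵛ m r) (↑ᵗ m xs) (↑ᵗ m zs) (tup m) ⟦ ys ⟧ ≡ Split r xs zs ys
    split-inst = trans (ren-Split (inst⃗ ys) (↑ᵛ m r) (↑ᵗ m xs) (↑ᵗ m zs) (tup m))
      (cong₄ Split (inst⃗-↑ᵛ ys r) (map-inst⃗-↑ᵗ ys xs) (map-inst⃗-↑ᵗ ys zs) (map-inst⃗-tup ys))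

  Fiber-elim : {c r : Δ ∋ K} (xs : Tuple Δ n) → Φs ⊩ Fiber c r xs → (zs : Tuple Δ K) →
    Φs ⊩ app c zs ⇔ InFiber r xs zs
  Fiber-elim {c = c} {r} xs d zs = recast (cong₂ _⇔_ (inst-app⃗ c zs)
    (trans (ren-InFiber (inst⃗ zs) (↑ᵛ K r) (↑ᵗ K xs) (tup K))
           (cong₃ InFiber (inst⃗-↑ᵛ zs r) (map-inst⃗-↑ᵗ zs xs) (map-inst⃗-tup zs))))
    (∀ⁿE d zs)

  Fiber-exists : (r : Δ ∋ K) (xs : Tuple Δ n) → Φs ⊩ ∃' K (Fiber here (there r) (V.map there xs))
  Fiber-exists r xs = recast (cong (λ φ → ∃' K (∀ⁿ K (app⃗ here ⇔ φ))) (trans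
    (ren-InFiber (liftR (ι^ K) there) (↑ᵛ K r) (↑ᵗ K xs) (tup K))
    (cong₃ InFiber (liftR-wkR (ι^ K) there r) (map-liftR-↑ᵗ there xs) (map-liftR-tup there))))
    (axiom (ax-comp _ (InFiber (↑ᵛ K r) (↑ᵗ K xs) (tup K))))

  IsFiber-intro : {c r : Δ ∋ K} {a : Δ ∋ n} (xs : Tuple Δ n) →
    Φs ⊩ app a xs → Φs ⊩ Fiber c r xs → Φs ⊩ IsFiber c r a
  IsFiber-intro {c = c} {r} {a} xs ax F = ∃ⁿI xs (recast (sym (cong₂ _∧'_ (inst-app⃗ a xs)
    (trans (ren-Fiber (inst⃗ xs) (↑ᵛ n c) (↑ᵛ n r) (tup n))
           (cong₃ Fiber (inst⃗-↑ᵛ xs c) (inst⃗-↑ᵛ xs r) (map-inst⃗-tup xs)))))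
    (∧I ax F))

  IsDom-elim : {a : Δ ∋ n} {r : Δ ∋ K} → Φs ⊩ IsDom a r → (xs : Tuple Δ n) → Φs ⊩ app a xs ⇔ InDom r xs
  IsDom-elim {a = a} {r} D xs = recast (cong₂ _⇔_ (inst-app⃗ a xs)
    (trans (ren-InDom (inst⃗ xs) (↑ᵛ n r) (tup n)) (cong₂ InDom (inst⃗-↑ᵛ xs r) (map-inst⃗-tup xs))))
    (∀ⁿE D xs)

  Transversal-elim : {d r : Δ ∋ K} {a : Δ ∋ n} → Φs ⊩ Transversal d r a → (c : Δ ∋ K) →
    Φs ⊩ Candidate c r a ⇒ MeetsOnce c d
  Transversal-elim {d = d} {r} {a} T c = recast (cong₂ _⇒_
    (ren-Candidate (sub1 c) here (there r) (there a)) (ren-MeetsOnce (sub1 c) here (there d)))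
    (∀E T c)

  SelectsAt-intro : (r s : Δ ∋ K) (xs : Tuple Δ n) (ys : Tuple Δ m) →
    Φs ⊩ app₂ r xs ys → Φs ⊩ app₂ s xs ys →
    (app₂ (↑ᵛ m r) (↑ᵗ m xs) (tup m) ∧' app₂ (↑ᵛ m s) (↑ᵗ m xs) (tup m) ∷ ↑ˡ m Φs)
      ⊩ tup m ≋ ↑ᵗ m ys →
    Φs ⊩ SelectsAt r s xs
  SelectsAt-intro r s xs ys dr ds u =
    ∃!!ⁿI ys (recast (sym (cong₂ _∧'_ (inst-app₂ r) (inst-app₂ s))) (∧I dr ds)) u
    where
    inst-app₂ : (p : _ ∋ K) → app₂ (↑ᵛ m p) (↑ᵗ m xs) (tup m) ⟦ ys ⟧ ≡ app₂ p xs ys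
    inst-app₂ p = trans (ren-app₂ (inst⃗ ys) (↑ᵛ m p) (↑ᵗ m xs) (tup m))
      (cong₃ app₂ (inst⃗-↑ᵛ ys p) (map-inst⃗-↑ᵗ ys xs) (map-inst⃗-tup ys))

  InFiber-transport : {r : Δ ∋ K} {xs₁ xs₂ : Tuple Δ n} (zs : Tuple Δ K) →
    Φs ⊩ xs₁ ≋ xs₂ → Φs ⊩ InFiber r xs₁ zs → Φs ⊩ InFiber r xs₂ zs
  InFiber-transport {Δ = Δ} {r = r} {xs₁} {xs₂} zs e d =
    recast (over xs₂) (≋-subst (InFiber (↑ᵛ n r) (tup n) (↑ᵗ n zs)) e (recast (sym (over xs₁)) d))
    where
    over : (xs : Tuple Δ n) → InFiber (↑ᵛ n r) (tup n) (↑ᵗ n zs) ⟦ xs ⟧ ≡ InFiber r xs zs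
    over xs = trans (ren-InFiber (inst⃗ xs) (↑ᵛ n r) (tup n) (↑ᵗ n zs))
      (cong₃ InFiber (inst⃗-↑ᵛ xs r) (map-inst⃗-tup xs) (map-inst⃗-↑ᵗ xs zs))

  InFiber-split-base : (r : Δ ∋ K) (xs₁ xs₂ : Tuple Δ n) (zs : Tuple Δ K) (ys₁ : Tuple Δ m) →
    Φs ⊩ zs ≋ (xs₁ V.++ ys₁) → Φs ⊩ InFiber r xs₂ zs → Φs ⊩ xs₁ ≋ xs₂
  InFiber-split-base {Φs = Φs} r xs₁ xs₂ zs ys₁ e₁ d₂ =
    ≋⟨ ∃ⁿE₂ d₂ (↓≋ m xs₁ xs₂ (≋-++ˡ (↑ᵗ m ys₁) (tup m) (≋-trans (≋-sym e₁′) ≋⟨ #0 ⟩))) ⟩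
    where
    e₁′ : (_ ∷ _ ∷ ↑ˡ m Φs) ⊩ ↑ᵗ m zs ≋ (↑ᵗ m xs₁ V.++ ↑ᵗ m ys₁)
    e₁′ = subst (_ ⊩ ↑ᵗ m zs ≋_) (map-++ _ xs₁ ys₁) (skip≋ (skip≋ (↑≋ m e₁)))

  InFiber-base-unique : (r : Δ ∋ K) (xs₁ xs₂ : Tuple Δ n) (zs : Tuple Δ K) →
    Φs ⊩ InFiber r xs₁ zs → Φs ⊩ InFiber r xs₂ zs → Φs ⊩ xs₁ ≋ xs₂
  InFiber-base-unique r xs₁ xs₂ zs d₁ d₂ = ≋⟨ ∃ⁿE₂ d₁ (↓≋ m xs₁ xs₂
    (InFiber-split-base (↑ᵛ m r) (↑ᵗ m xs₁) (↑ᵗ m xs₂) (↑ᵗ m zs) (tup m) ≋⟨ #0 ⟩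
      (↑⊩₂ m (ren-InFiber (↑ᵛ m) r xs₂ zs) d₂))) ⟩

  Fiber-inhabited : (c r : Δ ∋ K) (xs : Tuple Δ n) →
    Φs ⊩ Fiber c r xs → Φs ⊩ InDom r xs → Φs ⊩ Inhabited c
  Fiber-inhabited c r xs F d = ∃ⁿE d (recast (sym (ren-Inhabited (↑ᵛ m) c))
    (∃ⁿI xy (recast (sym (inst-app⃗ (↑ᵛ m c) xy))
      (⇔E₂ (Fiber-elim (↑ᵗ m xs) (↑⊩₁ m (ren-Fiber (↑ᵛ m) c r xs) F) xy)
           (InFiber-intro (tup m) ≋-refl #0)))))
    where
    xy = ↑ᵗ m xs V.++ tup m

  IsFiber-inhabited : (c r : Δ ∋ K) (a : Δ ∋ n) →
    Φs ⊩ IsDom a r → Φs ⊩ IsFiber c r a → Φs ⊩ Inhabited c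
  IsFiber-inhabited c r a D I = ∃ⁿE₂ I (recast (sym (ren-Inhabited (↑ᵛ n) c))
    (Fiber-inhabited (↑ᵛ n c) (↑ᵛ n r) (tup n) #1
      (⇔E₁ (IsDom-elim (↑⊩₂ n (ren-IsDom (↑ᵛ n) a r) D) (tup n)) #0)))

  Fiber-cong : {c₁ c₂ r : Δ ∋ K} {xs₁ xs₂ : Tuple Δ n} {zs : Tuple Δ K} →
    Φs ⊩ Fiber c₁ r xs₁ → Φs ⊩ Fiber c₂ r xs₂ → Φs ⊩ xs₁ ≋ xs₂ →
    Φs ⊩ app c₁ zs → Φs ⊩ app c₂ zs
  Fiber-cong {xs₁ = xs₁} {xs₂} {zs} F₁ F₂ e a =
    ⇔E₂ (Fiber-elim xs₂ F₂ zs) (InFiber-transport zs e (⇔E₁ (Fiber-elim xs₁ F₁ zs) a))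

  Fibers-meet⇒coextensive : (c₁ c₂ r : Δ ∋ K) (xs₁ xs₂ : Tuple Δ n) (zs : Tuple Δ K) →
    Φs ⊩ Fiber c₁ r xs₁ → Φs ⊩ Fiber c₂ r xs₂ → Φs ⊩ app c₁ zs → Φs ⊩ app c₂ zs →
    Φs ⊩ Coextensive c₁ c₂
  Fibers-meet⇒coextensive c₁ c₂ r xs₁ xs₂ zs F₁ F₂ a₁ a₂ =
    ∀ⁿI (⇔I (Fiber-cong (skip F₁′) (skip F₂′) (skip≋ (↑≋ K base)) #0)
            (Fiber-cong (skip F₂′) (skip F₁′) (skip≋ (↑≋ K (≋-sym base))) #0))
    where
    base = InFiber-base-unique r xs₁ xs₂ zs
      (⇔E₁ (Fiber-elim xs₁ F₁ zs) a₁) (⇔E₁ (Fiber-elim xs₂ F₂ zs) a₂)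
    F₁′ = recast (ren-Fiber (↑ᵛ K) c₁ r xs₁) (↑⊩ K F₁)
    F₂′ = recast (ren-Fiber (↑ᵛ K) c₂ r xs₂) (↑⊩ K F₂)

  Fiber-IsFiber-meet⇒coextensive : (c₁ c₂ r : Δ ∋ K) (a : Δ ∋ n) (xs₁ : Tuple Δ n) (zs : Tuple Δ K) →
    Φs ⊩ Fiber c₁ r xs₁ → Φs ⊩ IsFiber c₂ r a → Φs ⊩ app c₁ zs → Φs ⊩ app c₂ zs →
    Φs ⊩ Coextensive c₁ c₂
  Fiber-IsFiber-meet⇒coextensive c₁ c₂ r a xs₁ zs F₁ I₂ a₁ a₂ = ∃ⁿE₂ I₂
    (recast (sym (ren-Coextensive (↑ᵛ n) c₁ c₂))
      (Fibers-meet⇒coextensive (↑ᵛ n c₁) (↑ᵛ n c₂) (↑ᵛ n r) (↑ᵗ n xs₁) (tup n) (↑ᵗ n zs)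
        (↑⊩₂ n (ren-Fiber (↑ᵛ n) c₁ r xs₁) F₁) #1 (↑⊩₂ n refl a₁) (↑⊩₂ n refl a₂)))

  IsFibers-meet⇒coextensive : (c₁ c₂ r : Δ ∋ K) (a : Δ ∋ n) (zs : Tuple Δ K) →
    Φs ⊩ IsFiber c₁ r a → Φs ⊩ IsFiber c₂ r a → Φs ⊩ app c₁ zs → Φs ⊩ app c₂ zs →
    Φs ⊩ Coextensive c₁ c₂
  IsFibers-meet⇒coextensive c₁ c₂ r a zs I₁ I₂ a₁ a₂ = ∃ⁿE₂ I₁
    (recast (sym (ren-Coextensive (↑ᵛ n) c₁ c₂))
      (Fiber-IsFiber-meet⇒coextensive (↑ᵛ n c₁) (↑ᵛ n c₂) (↑ᵛ n r) (↑ᵛ n a) (tup n) (↑ᵗ n zs)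
        #1 (↑⊩₂ n (ren-IsFiber (↑ᵛ n) c₂ r a) I₂) (↑⊩₂ n refl a₁) (↑⊩₂ n refl a₂)))

  IsFibers-disjoint : (c₁ c₂ r : Δ ∋ K) (a : Δ ∋ n) →
    Φs ⊩ IsFiber c₁ r a → Φs ⊩ IsFiber c₂ r a → Φs ⊩ c₁ ≠' c₂ → Φs ⊩ Disjoint c₁ c₂
  IsFibers-disjoint c₁ c₂ r a I₁ I₂ ne = ⇒I (∃ⁿE₂ #0
    (⇒E (↑⊩₂ K (ren-≠' (↑ᵛ K) c₁ c₂) (skip ne))
      (IsFibers-meet⇒coextensive (↑ᵛ K c₁) (↑ᵛ K c₂) (↑ᵛ K r) (↑ᵛ K a) (tup K)
        (↑⊩₂ K (ren-IsFiber (↑ᵛ K) c₁ r a) (skip I₁)) (↑⊩₂ K (ren-IsFiber (↑ᵛ K) c₂ r a) (skip I₂))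
        #0 #1)))

  OnlyCommon⇒SelectsAt : (c d r : Δ ∋ K) (xs : Tuple Δ n) (zs : Tuple Δ K) (ys : Tuple Δ m) →
    Φs ⊩ Fiber c r xs → Φs ⊩ OnlyCommon c d zs → Φs ⊩ app d zs →
    Φs ⊩ zs ≋ (xs V.++ ys) → Φs ⊩ app r zs → Φs ⊩ SelectsAt r d xs
  OnlyCommon⇒SelectsAt {Φs = Φs} c d r xs zs ys F U dz e rz =
    SelectsAt-intro r d xs ys (≋-app e rz) (≋-app e dz)
      (≋-++ʳ (↑ᵗ m xs) (↑ᵗ m xs) (≋-trans xy≋zs zs≋xys))
    where
    xy = ↑ᵗ m xs V.++ tup m
    Ψs = app₂ (↑ᵛ m r) (↑ᵗ m xs) (tup m) ∧' app₂ (↑ᵛ m d) (↑ᵗ m xs) (tup m) ∷ ↑ˡ m Φs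
    c-xy : Ψs ⊩ app (↑ᵛ m c) xy
    c-xy = ⇔E₂ (Fiber-elim (↑ᵗ m xs) (↑⊩₁ m (ren-Fiber (↑ᵛ m) c r xs) F) xy)
               (InFiber-intro (tup m) ≋-refl (∧E₁ #0))
    xy≋zs : Ψs ⊩ xy ≋ ↑ᵗ m zs
    xy≋zs = UniqueAt-elim (↑⊩₁ m (ren-OnlyCommon (↑ᵛ m) c d zs) U) xy
      (recast (sym (cong₂ _∧'_ (inst-app⃗ (↑ᵛ m c) xy) (inst-app⃗ (↑ᵛ m d) xy))) (∧I c-xy (∧E₂ #0)))
    zs≋xys : Ψs ⊩ ↑ᵗ m zs ≋ (↑ᵗ m xs V.++ ↑ᵗ m ys)
    zs≋xys = skip≋ (subst (_ ⊩ ↑ᵗ m zs ≋_) (map-++ _ xs ys) (↑≋ m e))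

  MeetsOnce⇒SelectsAt : (c d r : Δ ∋ K) (xs : Tuple Δ n) →
    Φs ⊩ Fiber c r xs → Φs ⊩ MeetsOnce c d → Φs ⊩ SelectsAt r d xs
  MeetsOnce⇒SelectsAt c d r xs F M = ∃!!ⁿE M (recast (sym (ren-SelectsAt (↑ᵛ K) r d xs))
    (∃ⁿE₂ (⇔E₁ (Fiber-elim (↑ᵗ K xs) F′ (tup K)) (∧E₁ #0))
      (recast (sym (ren-SelectsAt (↑ᵛ m) (↑ᵛ K r) (↑ᵛ K d) (↑ᵗ K xs)))
        (OnlyCommon⇒SelectsAt (↑ᵛ m (↑ᵛ K c)) (↑ᵛ m (↑ᵛ K d)) (↑ᵛ m (↑ᵛ K r))
          (↑ᵗ m (↑ᵗ K xs)) (↑ᵗ m (tup K)) (tup m)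
          (↑⊩₂ m (ren-Fiber (↑ᵛ m) (↑ᵛ K c) (↑ᵛ K r) (↑ᵗ K xs)) F′)
          (↑⊩₂ m (ren-OnlyCommon (↑ᵛ m) (↑ᵛ K c) (↑ᵛ K d) (tup K)) U)
          (↑⊩₂ m refl (∧E₂ #0)) ≋⟨ #0 ⟩ #1))))
    where
    F′ = skip (skip (recast (ren-Fiber (↑ᵛ K) c r xs) (↑⊩ K F)))
    U = recast (cong (λ φ → UniqueAt K φ (tup K))
                     (cong₂ _∧'_ (ren-app⃗ (↑ᵛ K) c) (ren-app⃗ (↑ᵛ K) d))) #1

  Transversal⇒SelectsAt : (d r : Δ ∋ K) (a : Δ ∋ n) (xs : Tuple Δ n) →
    Φs ⊩ IsDom a r → Φs ⊩ Transversal d r a → Φs ⊩ app a xs → Φs ⊩ SelectsAt r d xs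
  Transversal⇒SelectsAt d r a xs D T ax = ∃E (Fiber-exists r xs)
    (recast (sym (ren-SelectsAt there r d xs))
      (MeetsOnce⇒SelectsAt here (there d) (there r) (V.map there xs) #0
        (⇒E (Transversal-elim (skip (recast (ren-Transversal there d r a) (ren-⊩ there T))) here)
          (∧I (skip (recast (ren-IsDom there a r) (ren-⊩ there D)))
              (IsFiber-intro (V.map there xs) (skip (ren-⊩ there ax)) #0)))))

  Transversal⇒Selects : (d r : Δ ∋ K) (a : Δ ∋ n) →
    Φs ⊩ IsDom a r → Φs ⊩ Transversal d r a → Φs ⊩ Selects a r d
  Transversal⇒Selects d r a D T = ∀ⁿI (⇒I (Transversal⇒SelectsAt (↑ᵛ n d) (↑ᵛ n r) (↑ᵛ n a) (tup n)
    (↑⊩₁ n (ren-IsDom (↑ᵛ n) a r) D) (↑⊩₁ n (ren-Transversal (↑ᵛ n) d r a) T) #0))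

  Occ-IsFiber : (c r : Δ ∋ K) (a : Δ ∋ n) → Occ c (IsFiber c r a)
  Occ-IsFiber c r a = Occ-∃ⁿ n (Occ-∧ʳ (Occ-∀ⁿ K (Occ-⇔ˡ occP)))

  -- Context R ∷ A; under the binders, here is C (in H), S or D.
  H : Fm (K ∷ K ∷ n ∷ [])
  H = Candidate here (there here) (there (there here))

  selector-exists :
    [] ⊩ ∃' K (IsDom (there (there here)) (there here) ⇒ Selects (there (there here)) (there here) here)
  selector-exists = ∃E (⇒E (axiom (hyp (asser H (Occ-∧ʳ (Occ-IsFiber here (there here) (there (there here)))))))
      (∧I (∀I (⇒I (IsFiber-inhabited here (there here) (there (there here)) (∧E₁ #0) (∧E₂ #0))))
          (∀I (∀I (⇒I (IsFibers-disjoint (there here) here (there (there here)) (there (there (there here)))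
            (∧E₂ (recast (ren-Candidate _ here (there here) (there (there here))) (∧E₁ #0)))
            (∧E₂ (recast (ren-Candidate _ here (there here) (there (there here))) (∧E₁ (∧E₂ #0))))
            (∧E₂ (∧E₂ #0))))))))
    (∃I here (recast (sym (inst-ext-wk
        (IsDom (there (there here)) (there here) ⇒ Selects (there (there here)) (there here) here)))
      (⇒I (Transversal⇒Selects here (there here) (there (there here)) #0
        (skip (recast (cong (λ φ → ∀' K (φ ⇒ MeetsOnce here (there here)))
                            (ren-Candidate (ext there) here (there here) (there (there here))))
                      #0))))))


proposition2p5 : (n' m' : ℕ) → Choice* (suc n' + suc m') ⊢h AC n' m'
proposition2p5 n' m' = derivation (∀I (∀I selector-exists))
  where
  open Fibers n' (suc m')
  open Deduction (Choice* (suc n' + suc m'))
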